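{- For every integer $n\ge 0$, there are at least $2^n$ distinct $(n+2)$-planar-feasible vectors.
   Context: $\tau(G)$ is the number of spanning trees of a (multi)graph $G$ (parallel edges counted as distinct). For an edge $e$ of $G$, $G/e$ is the multigraph obtained by contracting $e$ and $G-e$ the graph obtained by deleting $e$. A vector $(t,u)^T$ of integers is $n$-planar-feasible if there exist a simple planar graph $G$ on at most $n$ vertices and an edge $e\in E(G)$ with $t=\tau(G/e)$ and $u=\tau(G-e)$. -}

module Defs where

open import Data.Nat as ℕ using (ℕ; zero; suc; _∸_; _≡ᵇ_)
open import Data.Bool using (Bool; true; false; _∧_; _∨_; not)
open import Data.Fin as Fin using (Fin; punchOut; _≟_)
open import Data.Fin.Properties using (<⇒≢)
open import Data.List using (List; []; _∷_; _++_; map; length; lookup; removeAt; allFin; filterᵇ)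
open import Data.Bool.ListAction using (any; all)
open import Data.List.Relation.Unary.All as All using (All)
open import Data.List.Relation.Unary.Unique.Propositional using (Unique)
open import Data.List.Membership.Propositional using (_∈_)
open import Data.List.Membership.Propositional.Properties using (∈-lookup)
open import Data.Product using (_×_; _,_; proj₁; proj₂; Σ; ∃)
open import Data.Sum using (_⊎_)
open import Data.Rational using (ℚ; 0ℚ; 1ℚ; _+_; _*_; _-_; _≤_)
open import Relation.Binary.PropositionalEquality using (_≡_; _≢_; sym)
open import Relation.Nullary.Decidable using (⌊_⌋; yes; no)
open import Function using (_∘_)

-- Finite multigraphs: vertex set Fin nV, a list of edges (each edge a
-- pair of endpoints).  Parallel edges are distinct list entries.

record Multigraph : Set where
  constructor mg
  field
    nV    : ℕ
    edges : List (Fin nV × Fin nV)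

-- all sub-multisets of a list, chosen by position (so parallel edges are
-- counted as distinct); 2^(length xs) entries
sublists : ∀ {A : Set} → List A → List (List A)
sublists []       = [] ∷ []
sublists (x ∷ xs) = map (x ∷_) (sublists xs) ++ sublists xs

_==_ : ∀ {v} → Fin v → Fin v → Bool
x == y = ⌊ x ≟ y ⌋

reachWithin : ∀ {v} → List (Fin v × Fin v) → ℕ → Fin v → Fin v → Bool
reachWithin S zero    x y = x == y
reachWithin S (suc k) x y =
  reachWithin S k x y ∨
  any (λ e → (reachWithin S k x (proj₁ e) ∧ (proj₂ e == y)) ∨
             (reachWithin S k x (proj₂ e) ∧ (proj₁ e == y))) S

connected : ∀ {v} → List (Fin v × Fin v) → Bool
connected {v} S = all (λ x → all (λ y → reachWithin S v x y) (allFin v)) (allFin v)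

isSpanningTree : ∀ {v} → List (Fin v × Fin v) → Bool
isSpanningTree {v} S = (length S ≡ᵇ (v ∸ 1)) ∧ connected S

τ : Multigraph → ℕ
τ (mg v E) = length (filterᵇ isSpanningTree (sublists E))

record SimpleGraph (v : ℕ) : Set where
  field
    edges    : List (Fin v × Fin v)
    ordered  : All (λ e → proj₁ e Fin.< proj₂ e) edges
    distinct : Unique edges
open SimpleGraph public

Edge : ∀ {v} → SimpleGraph v → Set
Edge G = Fin (length (edges G))

deleteEdge : ∀ {v} (G : SimpleGraph v) → Edge G → Multigraph
deleteEdge {v} G k = mg v (removeAt (edges G) k)

-- vertex map of the contraction of the edge ab: b is identified with a
merge : ∀ {k} (a b : Fin (suc k)) → a ≢ b → Fin (suc k) → Fin k
merge a b a≢b x with x ≟ b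
... | yes _   = punchOut {i = b} {j = a} (a≢b ∘ sym)
... | no x≢b  = punchOut {i = b} {j = x} (x≢b ∘ sym)

mapEdge : ∀ {m n} → (Fin m → Fin n) → Fin m × Fin m → Fin n × Fin n
mapEdge f (x , y) = f x , f y

contractEdge : ∀ {k} (G : SimpleGraph (suc k)) → Edge G → Multigraph
contractEdge {k} G i =
  mg k (map (mapEdge (merge a b a≢b)) (removeAt (edges G) i))
  where
    a = proj₁ (lookup (edges G) i)
    b = proj₂ (lookup (edges G) i)
    a≢b = <⇒≢ (All.lookup (ordered G) (∈-lookup i))

-- Planarity, via straight-line drawings with rational coordinates
-- (equivalent to planarity by Fáry's theorem).

Point : Set
Point = ℚ × ℚ

along : Point → Point → ℚ → Point
along (ax , ay) (bx , by) t = (ax + t * (bx - ax)) , (ay + t * (by - ay))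

InUnit : ℚ → Set
InUnit t = (0ℚ ≤ t) × (t ≤ 1ℚ)

record StraightLineEmbedding {v} (G : SimpleGraph v) (p : Fin v → Point) : Set where
  field
    injective : ∀ x y → p x ≡ p y → x ≡ y
    avoids    : ∀ {i j w} → (i , j) ∈ edges G → w ≢ i → w ≢ j →
                ∀ t → InUnit t → along (p i) (p j) t ≢ p w
    noCross   : ∀ {i j k l} → (i , j) ∈ edges G → (k , l) ∈ edges G →
                (i , j) ≢ (k , l) → ∀ s t → InUnit s → InUnit t →
                along (p i) (p j) s ≡ along (p k) (p l) t →
                Σ (Fin v) λ w → (w ≡ i ⊎ w ≡ j) × (w ≡ k ⊎ w ≡ l) ×
                                (along (p i) (p j) s ≡ p w)

Planar : ∀ {v} → SimpleGraph v → Set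
Planar {v} G = Σ (Fin v → Point) (StraightLineEmbedding G)

-- (t , u) is N-planar-feasible.  A graph with an edge has ≥ 1 vertex, so
-- we write the vertex count as suc k.

PlanarFeasible : ℕ → ℕ × ℕ → Set
PlanarFeasible N (t , u) =
  Σ ℕ λ k → (suc k ℕ.≤ N) ×
  Σ (SimpleGraph (suc k)) λ G → Planar G ×
  Σ (Edge G) λ e → (τ (contractEdge G e) ≡ t) × (τ (deleteEdge G e) ≡ u)

{-# OPTIONS --safe #-}

-- Let e join a hub h to a path end w, with t = τ(G/e) and u = τ(G − e), and
-- append to the path a new vertex w′ adjacent to w and h.  For the marked edge
-- e′ = hw′, deletion–contraction turns (t , u) into (2t + u , t + u), and into
-- (t + u , u) if the old edge e is removed.  Every graph obtained from K₂ in
-- this way is a subgraph of a fan, hence planar.  As long as u < t, the first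
-- map lands in t ≤ 2u and the second in t > 2u; both are injective, so
-- the 2ⁿ choices give different vectors.
module Submission where

open import Defs
open import Data.Bool using (Bool; true; false; T; _∧_)
open import Data.Bool.Properties using (T-∧; T-∨)
open import Data.Empty using (⊥-elim)
open import Data.Fin as Fin using (Fin; zero; suc; toℕ; punchIn; _≟_; combine; quotient; remainder)
open import Data.Fin.Patterns using (0F; 1F; 2F)
open import Data.Fin.Properties using (injective⇒≤; toℕ-injective; combine-remQuot; 2↔Bool; punchIn-punchOut; punchIn-injective; punchInᵢ≢i)
open import Data.List using (List; []; _∷_; _++_; map; length; filterᵇ; allFin; lookup)
open import Data.List.Membership.Propositional using (_∈_; _∉_; find; lose)
open import Data.List.Membership.Propositional.Properties using (∈-lookup; ∈-map⁺; ∈-map⁻; ∈-allFin)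
open import Data.List.Properties using (length-map; length-++; map-++; map-∘; map-cong; map-id; filter-++; filter-≐; filter-none)
open import Data.List.Relation.Unary.All as All using (All; []; _∷_)
open import Data.List.Relation.Unary.All.Properties using (all⁺; all⁻; map⁺; ¬Any⇒All¬)
open import Data.List.Relation.Unary.Any using (here; there)
open import Data.List.Relation.Unary.Any.Properties using (any⁺; any⁻)
open import Data.List.Relation.Unary.AllPairs using ([]; _∷_)
open import Data.List.Relation.Unary.Unique.Propositional using (Unique)
import Data.List.Relation.Unary.Unique.Propositional.Properties as Unique
open import Data.List.Membership.DecPropositional using (_∈?_)
open import Data.Nat as ℕ using (ℕ; zero; suc; _+_; _^_; _≡ᵇ_; _≤_; _<_; z≤n; s≤s)
import Data.Nat.Properties as ℕ
open import Data.Product using (Σ; ∃; _×_; _,_; proj₁; proj₂)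
open import Data.Rational as ℚ using (ℚ; 0ℚ; 1ℚ)
import Data.Rational.Properties as ℚ
open import Data.Rational.Solver using (module +-*-Solver)
open import Data.Sum using (_⊎_; inj₁; inj₂)
open import Data.Vec using (Vec; []; _∷_)
import Data.Vec.Properties as Vec
open import Function using (_∘_; id)
open import Function.Bundles using (Equivalence; Injection; Inverse)
open import Function.Definitions using (Injective)
open import Function.Properties.Inverse using (↔⇒↣)
open import Relation.Binary.Construct.Closure.Equivalence as Eq using (EqClosure)
open import Relation.Binary.Construct.Closure.ReflexiveTransitive using (ε; _◅_; _◅◅_)
open import Relation.Binary.Construct.Closure.Symmetric using (fwd; bwd)
open import Relation.Binary.Definitions using (tri<; tri≈; tri>)
open import Relation.Binary.PropositionalEquality
open import Relation.Nullary using (¬_; yes; no; contradiction)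
open import Relation.Nullary.Decidable using (toWitness; fromWitness; T?)

private variable
  m n k v : ℕ
  A B : Set

T-ext : ∀ {x y} → (T x → T y) → (T y → T x) → x ≡ y
T-ext {true}  {true}  _ _ = refl
T-ext {true}  {false} f _ = ⊥-elim (f _)
T-ext {false} {true}  _ g = ⊥-elim (g _)
T-ext {false} {false} _ _ = refl

-- Connectivity

-- An equivalence closure ignores the orientation of edges and folds into any other equivalence
-- relation; every transfer of connectedness below is such a fold.
Linked : List (Fin v × Fin v) → Fin v → Fin v → Set
Linked S = EqClosure (λ x y → (x , y) ∈ S)

Connected : List (Fin v × Fin v) → Set
Connected S = ∀ x y → Linked S x y

Adjacent : List (Fin v × Fin v) → Fin v → Fin v → Set
Adjacent S x y = (x , y) ∈ S ⊎ (y , x) ∈ S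

-- The index lists the visited vertices, latest first. Repetitions are excluded, so that the length
-- of a path is bounded by the number of vertices.
data Path (S : List (Fin v × Fin v)) (x : Fin v) : Fin v → List (Fin v) → Set where
  start  : Path S x x (x ∷ [])
  extend : ∀ {y z vs} → Path S x y vs → Adjacent S y z → z ∉ vs → Path S x z (z ∷ vs)

module _ {S : List (Fin v × Fin v)} where

  path-unique : ∀ {x y vs} → Path S x y vs → Unique vs
  path-unique start          = [] ∷ []
  path-unique (extend p _ z∉vs) = ¬Any⇒All¬ _ z∉vs ∷ path-unique p

  truncate : ∀ {x y z vs} → Path S x y vs → z ∈ vs → ∃ (Path S x z)
  truncate start          (here refl)  = _ , start
  truncate p@(extend _ _ _) (here refl)  = _ , p
  truncate (extend p _ _) (there z∈vs) = truncate p z∈vs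

  step : ∀ {x y z} → ∃ (Path S x y) → Adjacent S y z → ∃ (Path S x z)
  step {z = z} (vs , p) y~z with _∈?_ _≟_ z vs
  -- A revisited vertex would break uniqueness, so the path is cut back to its first visit.
  ... | yes z∈vs = truncate p z∈vs
  ... | no  z∉vs = _ , extend p y~z z∉vs

  linked⇒path : ∀ {x y z} → ∃ (Path S x y) → Linked S y z → ∃ (Path S x z)
  linked⇒path p ε            = p
  linked⇒path p (fwd e ◅ es) = linked⇒path (step p (inj₁ e)) es
  linked⇒path p (bwd e ◅ es) = linked⇒path (step p (inj₂ e)) es

  reach-refl : ∀ k {x} → T (reachWithin S k x x)
  reach-refl zero    = fromWitness refl
  reach-refl (suc k) = Equivalence.from T-∨ (inj₁ (reach-refl k))

  reach-step : ∀ k {x y z} → T (reachWithin S k x y) → Adjacent S y z →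
               T (reachWithin S (suc k) x z)
  reach-step k {x} {y} {z} r y~z = Equivalence.from (T-∨ {reachWithin S k x z}) (inj₂ (any⁺ _ (hop y~z)))
    where
    hop : Adjacent S y z → _
    hop (inj₁ e) = lose e (Equivalence.from T-∨ (inj₁ (Equivalence.from T-∧ (r , fromWitness refl))))
    hop (inj₂ e) = lose e (Equivalence.from (T-∨ {reachWithin S k x z ∧ _})
                     (inj₂ (Equivalence.from T-∧ (r , fromWitness refl))))

  reach-mono : ∀ {j k x y} → j ℕ.≤′ k → T (reachWithin S j x y) → T (reachWithin S k x y)
  reach-mono ℕ.≤′-refl       r = r
  reach-mono (ℕ.≤′-step j≤k) r = Equivalence.from T-∨ (inj₁ (reach-mono j≤k r))

  -- Rounds are counted by vertices, one more than the edges walked; this matches the `v` rounds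
  -- that `connected` allows.
  path⇒reach : ∀ {x y vs} → Path S x y vs → T (reachWithin S (length vs) x y)
  path⇒reach start            = reach-refl 1
  path⇒reach (extend {vs = vs} p y~z _) = reach-step (length vs) (path⇒reach p) y~z

  reach⇒linked : ∀ k {x y} → T (reachWithin S k x y) → Linked S x y
  reach⇒linked zero    r = subst (Linked S _) (toWitness r) ε
  reach⇒linked (suc k) {x} {y} r with Equivalence.to (T-∨ {reachWithin S k x y}) r
  ... | inj₁ r′ = reach⇒linked k r′
  ... | inj₂ a  with find (any⁻ _ S a)
  ...   | (i , j) , e∈S , h with Equivalence.to (T-∨ {reachWithin S k x i ∧ (j == y)}) h
  ...     | inj₁ h′ with Equivalence.to (T-∧ {reachWithin S k x i}) h′
  ...       | ri , j≡y = reach⇒linked k ri ◅◅ subst (Linked S i) (toWitness j≡y) (fwd e∈S ◅ ε)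
  reach⇒linked (suc k) {x} {y} r | inj₂ a | (i , j) , e∈S , h | inj₂ h′
      with Equivalence.to (T-∧ {reachWithin S k x j}) h′
  ...       | rj , i≡y = reach⇒linked k rj ◅◅ subst (Linked S j) (toWitness i≡y) (bwd e∈S ◅ ε)

lookup-injective : {xs : List A} → Unique xs → Injective _≡_ _≡_ (lookup xs)
lookup-injective (x≢ ∷ u) {zero}  {zero}  eq = refl
lookup-injective (x≢ ∷ u) {zero}  {suc j} eq = contradiction eq (All.lookup x≢ (∈-lookup j))
lookup-injective (x≢ ∷ u) {suc i} {zero}  eq = contradiction (sym eq) (All.lookup x≢ (∈-lookup i))
lookup-injective (x≢ ∷ u) {suc i} {suc j} eq = cong suc (lookup-injective u eq)

connected⇒Connected : (S : List (Fin v × Fin v)) → T (connected S) → Connected S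
connected⇒Connected {v} S c x y =
  reach⇒linked v (All.lookup (all⁺ _ _ (All.lookup (all⁺ _ _ c) (∈-allFin x))) (∈-allFin y))

Connected⇒connected : (S : List (Fin v × Fin v)) → Connected S → T (connected S)
Connected⇒connected {v} S c =
  all⁻ _ {allFin v} (All.universal (λ x → all⁻ _ {allFin v} (All.universal (λ y → reach x y) _)) _)
  where
  reach : ∀ x y → T (reachWithin S v x y)
  reach x y with linked⇒path (_ , start) (c x y)
  -- A repetition-free path embeds its positions into `Fin v`, so `v` rounds reach its end.
  ... | _ , p = reach-mono (ℕ.≤⇒≤′ (injective⇒≤ (lookup-injective (path-unique p)))) (path⇒reach p)

-- Contraction

module _ (a b : Fin (suc k)) (a≢b : a ≢ b) where

  private
    μ : Fin (suc k) → Fin k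
    μ = merge a b a≢b

    ρ : Fin k → Fin (suc k)
    ρ = punchIn b

  -- `ρ` picks the representative other than `b` in each class of `μ`; this case split is the only
  -- place in the module where `merge` is unfolded.
  punchIn-merge : ∀ x → (x ≡ b × ρ (μ x) ≡ a) ⊎ (x ≢ b × ρ (μ x) ≡ x)
  punchIn-merge x with x ≟ b
  ... | yes x≡b = inj₁ (x≡b , punchIn-punchOut _)
  ... | no  x≢b = inj₂ (x≢b , punchIn-punchOut _)

  merge-punchIn : ∀ j → μ (ρ j) ≡ j
  merge-punchIn j with punchIn-merge (ρ j)
  ... | inj₁ (ρj≡b , _) = contradiction ρj≡b (punchInᵢ≢i b j)
  ... | inj₂ (_ , eq)   = punchIn-injective b _ _ eq

  merge-identifies : μ a ≡ μ b
  merge-identifies with punchIn-merge a | punchIn-merge b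
  ... | inj₁ (a≡b , _) | _              = contradiction a≡b a≢b
  ... | inj₂ _         | inj₂ (b≢b , _) = contradiction refl b≢b
  ... | inj₂ (_ , p)   | inj₁ (_ , q)   = punchIn-injective b _ _ (trans p (sym q))

  module _ (S : List (Fin (suc k) × Fin (suc k))) where

    private
      S/e = map (mapEdge μ) S

    linked-merge : ∀ {x y} → Linked ((a , b) ∷ S) x y → Linked S/e (μ x) (μ y)
    linked-merge = Eq.gfold (Eq.isEquivalence _) μ λ where
      (here refl) → subst (Linked S/e (μ a)) merge-identifies ε
      (there e∈S) → Eq.return (∈-map⁺ (mapEdge μ) e∈S)

    -- A vertex differs from its representative only if it is `b`, and then the contracted edge
    -- joins the two.
    linked-lift : ∀ x → Linked ((a , b) ∷ S) x (ρ (μ x))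
    linked-lift x with punchIn-merge x
    ... | inj₁ (x≡b , eq) = subst₂ (Linked _) (sym x≡b) (sym eq) (bwd (here refl) ◅ ε)
    ... | inj₂ (_ , eq)   = subst (Linked _ x) (sym eq) ε

    -- An edge of `S/e` comes from some `(i , j)` in `S`; its ends may have moved from `b` to `a`,
    -- which a detour along the contracted edge repairs.
    linked-unmerge : ∀ {x y} → Linked S/e x y → Linked ((a , b) ∷ S) (ρ x) (ρ y)
    linked-unmerge = Eq.gfold (Eq.isEquivalence _) ρ λ e∈S/e → lift (∈-map⁻ (mapEdge μ) e∈S/e)
      where
      lift : ∀ {x y} → ∃ (λ e → e ∈ S × (x , y) ≡ mapEdge μ e) → Linked ((a , b) ∷ S) (ρ x) (ρ y)
      lift ((i , j) , e∈S , refl) =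
        Eq.symmetric _ (linked-lift i) ◅◅ fwd (there e∈S) ◅ linked-lift j

    Connected-contract : Connected ((a , b) ∷ S) → Connected S/e
    Connected-contract c x y =
      subst₂ (Linked S/e) (merge-punchIn x) (merge-punchIn y) (linked-merge (c (ρ x) (ρ y)))

    Connected-uncontract : Connected S/e → Connected ((a , b) ∷ S)
    Connected-uncontract c x y =
      linked-lift x ◅◅ linked-unmerge (c (μ x) (μ y)) ◅◅ Eq.symmetric _ (linked-lift y)

Connected-loop : ∀ (a : Fin v) S → Connected ((a , a) ∷ S) → Connected S
Connected-loop a S c x y = Eq.fold (Eq.isEquivalence _) (λ where
  (here refl) → ε
  (there e∈S) → Eq.return e∈S) (c x y)

-- Induction on the number of edges: a loop is dropped, and any other first edge is contracted, at
-- the cost of one vertex.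
Connected⇒enough-edges : ∀ (S : List (Fin v × Fin v)) → Connected S → v ≤ suc (length S)
Connected⇒enough-edges S = go (length S) S refl
  where
  -- The length is a separate argument because the contracted list is not a structural sublist.
  go : ∀ {v} l (S : List (Fin v × Fin v)) → length S ≡ l → Connected S → v ≤ suc l
  go {zero}        _       _ _ _ = z≤n
  go {suc zero}    _       _ _ _ = s≤s z≤n
  go {suc (suc v)} zero    [] _ c =
    contradiction (Eq.fold isEquivalence (λ ()) (c 0F 1F)) λ ()
  go {suc (suc v)} (suc l) ((a , b) ∷ S) eq c with a ≟ b
  ... | yes refl = ℕ.m≤n⇒m≤1+n (go l S (ℕ.suc-injective eq) (Connected-loop a S c))
  ... | no  a≢b  = s≤s (go l _ (trans (length-map _ S) (ℕ.suc-injective eq))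
                            (Connected-contract a b a≢b S c))

-- Spanning tree counts

¬T⇒false : ∀ {b} → ¬ T b → b ≡ false
¬T⇒false {true}  ¬t = contradiction _ ¬t
¬T⇒false {false} _  = refl

-- Contraction lowers both the edge count and the vertex count by one and preserves connectedness in
-- both directions. Splitting off the one-vertex case keeps the truncated subtraction exact.
isSpanningTree-contract : ∀ (a b : Fin (suc k)) (a≢b : a ≢ b) S →
  isSpanningTree ((a , b) ∷ S) ≡ isSpanningTree (map (mapEdge (merge a b a≢b)) S)
isSpanningTree-contract {zero}  0F 0F a≢b S = contradiction refl a≢b
isSpanningTree-contract {suc k} a  b  a≢b S = cong₂ _∧_
  (cong (_≡ᵇ k) (sym (length-map _ S)))
  (T-ext
    (Connected⇒connected _ ∘ Connected-contract a b a≢b S ∘ connected⇒Connected _)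
    (Connected⇒connected _ ∘ Connected-uncontract a b a≢b S ∘ connected⇒Connected _))

-- Without the loop the graph would still be connected, with one edge too few.
isSpanningTree-loop : ∀ (a : Fin v) S → isSpanningTree ((a , a) ∷ S) ≡ false
isSpanningTree-loop {suc zero}    a S = refl
isSpanningTree-loop {suc (suc v)} a S = ¬T⇒false λ t →
  let l≡v , c = Equivalence.to (T-∧ {length S ≡ᵇ v}) t
  in ℕ.1+n≰n (subst (λ l → suc (suc v) ≤ suc l) (ℕ.≡ᵇ⇒≡ _ _ l≡v)
       (Connected⇒enough-edges S (Connected-loop a S (connected⇒Connected _ c))))

-- No edge touches `b`, so the indicator of `b` is constant on components; yet there is a second
-- vertex.
isSpanningTree-isolated : ∀ (b : Fin (suc (suc m))) S →
  isSpanningTree (map (mapEdge (punchIn b)) S) ≡ false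
isSpanningTree-isolated {m} b S = ¬T⇒false λ t →
  let c = connected⇒Connected S′ (proj₂ (Equivalence.to (T-∧ {length S′ ≡ᵇ suc m}) t))
  in subst T (separated (c b (punchIn b 0F))) (fromWitness {a? = b ≟ b} refl)
  where
  S′ = map (mapEdge (punchIn b)) S

  punchIn-== : ∀ i → (punchIn b i == b) ≡ false
  punchIn-== i = ¬T⇒false (punchInᵢ≢i b i ∘ toWitness)

  constant : ∀ {x y} → ∃ (λ e → e ∈ S × (x , y) ≡ mapEdge (punchIn b) e) → (x == b) ≡ (y == b)
  constant ((i , j) , _ , refl) = trans (punchIn-== i) (sym (punchIn-== j))

  separated : Linked S′ b (punchIn b 0F) → (b == b) ≡ false
  separated l = trans (Eq.gfold isEquivalence (_== b) (constant ∘ ∈-map⁻ _) l) (punchIn-== 0F)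

-- Generalises `τ` to any predicate, so that fixing an edge or mapping the edges can be absorbed
-- into the predicate.
count : (List A → Bool) → List A → ℕ
count P xs = length (filterᵇ P (sublists xs))

filterᵇ-map : ∀ (P : B → Bool) (f : A → B) xs → filterᵇ P (map f xs) ≡ map f (filterᵇ (P ∘ f) xs)
filterᵇ-map P f []       = refl
filterᵇ-map P f (x ∷ xs) with P (f x)
... | true  = cong (f x ∷_) (filterᵇ-map P f xs)
... | false = filterᵇ-map P f xs

count-∷ : ∀ (P : List A → Bool) x xs → count P (x ∷ xs) ≡ count (P ∘ (x ∷_)) xs + count P xs
count-∷ P x xs = begin
  length (filterᵇ P (map (x ∷_) (sublists xs) ++ sublists xs))
    ≡⟨ cong length (filter-++ (T? ∘ P) (map (x ∷_) (sublists xs)) _) ⟩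
  length (filterᵇ P (map (x ∷_) (sublists xs)) ++ filterᵇ P (sublists xs))
    ≡⟨ length-++ (filterᵇ P (map (x ∷_) (sublists xs))) ⟩
  length (filterᵇ P (map (x ∷_) (sublists xs))) + count P xs
    ≡⟨ cong (λ ys → length ys + count P xs) (filterᵇ-map P (x ∷_) (sublists xs)) ⟩
  length (map (x ∷_) (filterᵇ (P ∘ (x ∷_)) (sublists xs))) + count P xs
    ≡⟨ cong (_+ count P xs) (length-map (x ∷_) (filterᵇ (P ∘ (x ∷_)) (sublists xs))) ⟩
  count (P ∘ (x ∷_)) xs + count P xs ∎
  where open ≡-Reasoning

count-cong : ∀ {P Q : List A → Bool} → P ≗ Q → ∀ xs → count P xs ≡ count Q xs
count-cong P≗Q xs = cong length
  (filter-≐ _ _ ((λ {S} → subst T (P≗Q S)) , (λ {S} → subst T (sym (P≗Q S)))) (sublists xs))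

count-none : ∀ {P : List A → Bool} → (∀ S → P S ≡ false) → ∀ xs → count P xs ≡ 0
count-none never xs = cong length (filter-none _ (All.universal (λ S → subst T (never S)) (sublists xs)))

sublists-map : ∀ (f : A → B) xs → sublists (map f xs) ≡ map (map f) (sublists xs)
sublists-map f []       = refl
sublists-map f (x ∷ xs) = begin
  map (f x ∷_) (sublists (map f xs)) ++ sublists (map f xs)
    ≡⟨ cong (λ ys → map (f x ∷_) ys ++ ys) (sublists-map f xs) ⟩
  map (f x ∷_) (map (map f) (sublists xs)) ++ map (map f) (sublists xs)
    ≡⟨ cong (_++ map (map f) (sublists xs)) (trans (sym (map-∘ (sublists xs))) (map-∘ (sublists xs))) ⟩
  map (map f) (map (x ∷_) (sublists xs)) ++ map (map f) (sublists xs)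
    ≡⟨ map-++ (map f) (map (x ∷_) (sublists xs)) (sublists xs) ⟨
  map (map f) (map (x ∷_) (sublists xs) ++ sublists xs) ∎
  where open ≡-Reasoning

count-map : ∀ (P : List B → Bool) (f : A → B) xs → count P (map f xs) ≡ count (P ∘ map f) xs
count-map P f xs = begin
  length (filterᵇ P (sublists (map f xs)))            ≡⟨ cong (length ∘ filterᵇ P) (sublists-map f xs) ⟩
  length (filterᵇ P (map (map f) (sublists xs)))      ≡⟨ cong length (filterᵇ-map P (map f) (sublists xs)) ⟩
  length (map (map f) (filterᵇ (P ∘ map f) (sublists xs))) ≡⟨ length-map (map f) (filterᵇ (P ∘ map f) (sublists xs)) ⟩
  count (P ∘ map f) xs ∎
  where open ≡-Reasoning

-- Spanning trees are split by whether they contain the edge; those that do correspond to spanning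
-- trees of the contraction.
τ-deletion-contraction : ∀ (a b : Fin (suc k)) (a≢b : a ≢ b) E →
  τ (mg (suc k) ((a , b) ∷ E)) ≡ τ (mg k (map (mapEdge (merge a b a≢b)) E)) + τ (mg (suc k) E)
τ-deletion-contraction a b a≢b E = trans (count-∷ isSpanningTree (a , b) E)
  (cong (_+ count isSpanningTree E)
    (trans (count-cong (isSpanningTree-contract a b a≢b) E)
           (sym (count-map isSpanningTree (mapEdge (merge a b a≢b)) E))))

τ-loop : ∀ (a : Fin v) E → τ (mg v ((a , a) ∷ E)) ≡ τ (mg v E)
τ-loop a E = trans (count-∷ isSpanningTree (a , a) E)
  (cong (_+ count isSpanningTree E) (count-none (isSpanningTree-loop a) E))

τ-isolated : ∀ (b : Fin (suc (suc m))) E → τ (mg (suc (suc m)) (map (mapEdge (punchIn b)) E)) ≡ 0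
τ-isolated b E = trans (count-map isSpanningTree (mapEdge (punchIn b)) E)
  (count-none (isSpanningTree-isolated b) E)

-- Fans

-- Vertex 0 is the hub and 1 the most recent vertex of the path 1, 2, 3, …; the
-- marked edge is the spoke (0 , 1).  A new vertex takes the index 1, so that
-- older vertices are renumbered by punchIn 1F; the bit tells whether the
-- formerly marked spoke, now (0 , 2), is kept.
spoke : Fin (suc (suc n)) × Fin (suc (suc n))
spoke = 0F , 1F

rim : Fin (suc (suc (suc n))) × Fin (suc (suc (suc n)))
rim = 1F , 2F

unmarked : Vec Bool n → List (Fin (suc (suc n)) × Fin (suc (suc n)))
unmarked []           = []
unmarked (false ∷ bs) = rim ∷ map (mapEdge (punchIn 1F)) (unmarked bs)
unmarked (true  ∷ bs) = rim ∷ map (mapEdge (punchIn 1F)) (spoke ∷ unmarked bs)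

-- The sum `t + (t + u)` is bracketed as deletion-contraction of a doubled spoke produces it.
dropSpoke keepSpoke : ℕ × ℕ → ℕ × ℕ
dropSpoke (t , u) = t + u , u
keepSpoke (t , u) = t + (t + u) , t + u

treeVector : Vec Bool n → ℕ × ℕ
-- The graph K₂: contracting its edge leaves one vertex, deleting it leaves two isolated ones.
treeVector []           = 1 , 0
treeVector (false ∷ bs) = dropSpoke (treeVector bs)
treeVector (true  ∷ bs) = keepSpoke (treeVector bs)

-- Spanning trees of fans

map-mapEdge-inverse : ∀ (f : Fin n → Fin m) (g : Fin m → Fin n) → (∀ i → g (f i) ≡ i) →
                      ∀ E → map (mapEdge g) (map (mapEdge f) E) ≡ E
map-mapEdge-inverse f g gf E = begin
  map (mapEdge g) (map (mapEdge f) E) ≡⟨ map-∘ E ⟨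
  map (mapEdge g ∘ mapEdge f) E       ≡⟨ map-cong (λ (i , j) → cong₂ _,_ (gf i) (gf j)) E ⟩
  map id E                            ≡⟨ map-id E ⟩
  E                                   ∎
  where open ≡-Reasoning

merge-rim-punchIn : ∀ (1≢2 : 1F ≢ 2F) (i : Fin (suc (suc n))) → merge 1F 2F 1≢2 (punchIn 1F i) ≡ i
merge-rim-punchIn _ 0F            = refl
merge-rim-punchIn _ 1F            = refl
merge-rim-punchIn _ (suc (suc i)) = refl

-- The rim is the only edge at the new vertex, hence a bridge: deleting it isolates `1F`, and
-- contracting it undoes the renumbering.
τ-rim : ∀ (E : List (Fin (suc (suc n)) × Fin (suc (suc n)))) →
        τ (mg (suc (suc (suc n))) (rim ∷ map (mapEdge (punchIn 1F)) E)) ≡ τ (mg (suc (suc n)) E)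
τ-rim {n} E = begin
  τ (mg _ (rim ∷ map (mapEdge (punchIn 1F)) E))
    ≡⟨ τ-deletion-contraction 1F 2F 1≢2 (map (mapEdge (punchIn 1F)) E) ⟩
  τ (mg _ (map (mapEdge (merge 1F 2F 1≢2)) (map (mapEdge (punchIn 1F)) E))) + τ (mg _ (map (mapEdge (punchIn 1F)) E))
    ≡⟨ cong₂ _+_ (cong (τ ∘ mg _) (map-mapEdge-inverse _ _ (merge-rim-punchIn 1≢2) E)) (τ-isolated 1F E) ⟩
  τ (mg _ E) + 0
    ≡⟨ ℕ.+-identityʳ _ ⟩
  τ (mg _ E) ∎
  where
  open ≡-Reasoning
  1≢2 : _≢_ {A = Fin (suc (suc (suc n)))} 1F 2F
  1≢2 ()

-- Contracting the marked spoke turns the rim into the marked spoke of the smaller fan, parallel to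
-- the old spoke if that was kept. Deleting it leaves the new vertex pendant. The proof of `0F ≢ 1F`
-- is arbitrary so as to match the one inside `contractEdge`.
τ-contract : ∀ (bs : Vec Bool n) (0≢1 : 0F ≢ 1F) →
             τ (mg (suc n) (map (mapEdge (merge 0F 1F 0≢1)) (unmarked bs))) ≡ proj₁ (treeVector bs)
τ-delete   : ∀ (bs : Vec Bool n) → τ (mg (suc (suc n)) (unmarked bs)) ≡ proj₂ (treeVector bs)
τ-fan      : ∀ (bs : Vec Bool n) → τ (mg (suc (suc n)) (spoke ∷ unmarked bs)) ≡
             proj₁ (treeVector bs) + proj₂ (treeVector bs)

τ-contract []                   _   = refl
τ-contract {suc n} (false ∷ bs) 0≢1 = trans
  (cong (λ E → τ (mg _ (spoke ∷ E))) (map-mapEdge-inverse _ _ (merge-punchIn 0F 1F 0≢1) (unmarked bs)))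
  (τ-fan bs)
τ-contract {suc n} (true ∷ bs)  0≢1 = begin
  τ (mg _ (spoke ∷ map (mapEdge (merge 0F 1F 0≢1)) (map (mapEdge (punchIn 1F)) (spoke ∷ unmarked bs))))
    ≡⟨ cong (λ E → τ (mg _ (spoke ∷ E))) (map-mapEdge-inverse _ _ (merge-punchIn 0F 1F 0≢1) (spoke ∷ unmarked bs)) ⟩
  τ (mg _ (spoke ∷ spoke ∷ unmarked bs))
    -- Contracting one of the two parallel spokes makes the other a loop, which lies in no spanning
    -- tree.
    ≡⟨ τ-deletion-contraction 0F 1F (λ ()) (spoke ∷ unmarked bs) ⟩
  τ (mg _ ((0F , 0F) ∷ map (mapEdge (merge 0F 1F (λ ()))) (unmarked bs))) + τ (mg _ (spoke ∷ unmarked bs))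
    ≡⟨ cong₂ _+_ (trans (τ-loop 0F (map (mapEdge (merge 0F 1F (λ ()))) (unmarked bs))) (τ-contract bs _)) (τ-fan bs) ⟩
  _ ∎
  where open ≡-Reasoning

τ-delete []           = refl
τ-delete (false ∷ bs) = trans (τ-rim (unmarked bs)) (τ-delete bs)
τ-delete (true ∷ bs)  = trans (τ-rim (spoke ∷ unmarked bs)) (τ-fan bs)

τ-fan bs = trans (τ-deletion-contraction 0F 1F (λ ()) (unmarked bs))
  (cong₂ _+_ (τ-contract bs _) (τ-delete bs))

-- Distinctness of the tree vectors

treeVector-ordered : ∀ (bs : Vec Bool n) → proj₂ (treeVector bs) < proj₁ (treeVector bs)
treeVector-ordered []           = s≤s z≤n
-- Under either map the new difference of the components is the old `t`, which is positive.
treeVector-ordered (false ∷ bs) = ℕ.m<n+m _ (ℕ.≤-<-trans z≤n (treeVector-ordered bs))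
treeVector-ordered (true ∷ bs)  = ℕ.m<n+m _ (ℕ.≤-<-trans z≤n (treeVector-ordered bs))

dropSpoke-injective : Injective _≡_ _≡_ dropSpoke
dropSpoke-injective {t , u} {t′ , u′} eq with cong proj₂ eq
... | refl = cong (_, u) (ℕ.+-cancelʳ-≡ u t t′ (cong proj₁ eq))

keepSpoke-injective : Injective _≡_ _≡_ keepSpoke
keepSpoke-injective {t , u} {t′ , u′} eq
  with ℕ.+-cancelʳ-≡ (t + u) t t′ (trans (cong proj₁ eq) (cong (t′ +_) (sym (cong proj₂ eq))))
... | refl = cong (t ,_) (ℕ.+-cancelˡ-≡ t u u′ (cong proj₂ eq))

-- Equal images have equal differences of components, so `t = t′`; the second components then give
-- `u = t′ + u′ ≥ t`.
dropSpoke≢keepSpoke : ∀ {t u} w → u < t → dropSpoke (t , u) ≢ keepSpoke w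
dropSpoke≢keepSpoke {t} {u} (t′ , u′) u<t eq = ℕ.<⇒≱ u<t (begin
  t       ≡⟨ ℕ.+-cancelʳ-≡ u t t′ (trans (cong proj₁ eq) (cong (t′ +_) (sym (cong proj₂ eq)))) ⟩
  t′      ≤⟨ ℕ.m≤m+n t′ u′ ⟩
  t′ + u′ ≡⟨ cong proj₂ eq ⟨
  u       ∎)
  where open ℕ.≤-Reasoning

treeVector-injective : Injective _≡_ _≡_ (treeVector {n})
treeVector-injective {x = []}         {[]}         _  = refl
treeVector-injective {x = false ∷ bs} {false ∷ cs} eq = cong (false ∷_) (treeVector-injective (dropSpoke-injective eq))
treeVector-injective {x = true ∷ bs}  {true ∷ cs}  eq = cong (true ∷_) (treeVector-injective (keepSpoke-injective eq))
treeVector-injective {x = false ∷ bs} {true ∷ cs}  eq =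
  contradiction eq (dropSpoke≢keepSpoke (treeVector cs) (treeVector-ordered bs))
treeVector-injective {x = true ∷ bs}  {false ∷ cs} eq =
  contradiction (sym eq) (dropSpoke≢keepSpoke (treeVector bs) (treeVector-ordered cs))

-- Fans as simple graphs

data FanEdge : Fin (suc m) × Fin (suc m) → Set where
  isSpoke : ∀ i → FanEdge {m} (zero , suc i)
  -- Consecutiveness is stated through `toℕ`, so that shifting both ends preserves it by `cong suc`.
  isRim   : ∀ {i j} → toℕ j ≡ suc (toℕ i) → FanEdge {m} (suc i , suc j)

FanEdge-ordered : ∀ {e : Fin (suc m) × Fin (suc m)} → FanEdge e → proj₁ e Fin.< proj₂ e
FanEdge-ordered (isSpoke i) = s≤s z≤n
FanEdge-ordered (isRim eq)  = s≤s (ℕ.≤-reflexive (sym eq))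

FanEdge-punchIn : ∀ {e : Fin (suc (suc m)) × Fin (suc (suc m))} →
                  FanEdge e → FanEdge (mapEdge (punchIn 1F) e)
FanEdge-punchIn (isSpoke i) = isSpoke (suc i)
FanEdge-punchIn (isRim eq)  = isRim (cong suc eq)

unmarked-FanEdge : ∀ (bs : Vec Bool n) → All FanEdge (unmarked bs)
unmarked-FanEdge []           = []
unmarked-FanEdge (false ∷ bs) = isRim refl ∷ map⁺ (All.map FanEdge-punchIn (unmarked-FanEdge bs))
unmarked-FanEdge (true ∷ bs)  = isRim refl ∷ map⁺ (All.map FanEdge-punchIn (isSpoke 0F ∷ unmarked-FanEdge bs))

-- Both new edges contain `1F`, which `punchIn 1F` never hits.
unique-extend : ∀ {E : List (Fin (suc (suc n)) × Fin (suc (suc n)))} → Unique E →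
                Unique (spoke ∷ rim ∷ map (mapEdge (punchIn 1F)) E)
unique-extend {E = E} u =
  ((λ ()) ∷ map⁺ (All.universal (λ (_ , j) eq → punchInᵢ≢i 1F j (sym (cong proj₂ eq))) E)) ∷
  map⁺ (All.universal (λ (i , _) eq → punchInᵢ≢i 1F i (sym (cong proj₁ eq))) E) ∷
  Unique.map⁺ (λ eq → cong₂ _,_ (punchIn-injective 1F _ _ (cong proj₁ eq))
                                (punchIn-injective 1F _ _ (cong proj₂ eq))) u

fan-unique : ∀ (bs : Vec Bool n) → Unique (spoke ∷ unmarked bs)
fan-unique []           = [] ∷ []
fan-unique (true ∷ bs)  = unique-extend (fan-unique bs)
fan-unique (false ∷ bs) with fan-unique bs
... | _ ∷ u = unique-extend u

-- The marked edge heads the list, so removing position `0F` computes to `unmarked bs`.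
fan : Vec Bool n → SimpleGraph (suc (suc n))
fan bs = record
  { edges    = spoke ∷ unmarked bs
  ; ordered  = All.map FanEdge-ordered (isSpoke 0F ∷ unmarked-FanEdge bs)
  ; distinct = fan-unique bs
  }

-- Straight-line drawing of a fan

private
  module S = +-*-Solver

-- Defined by recursion so that consecutive abscissae differ by `1ℚ` definitionally.
abscissa : ℕ → ℚ
abscissa zero    = 0ℚ
abscissa (suc n) = abscissa n ℚ.+ 1ℚ

p<p+1 : ∀ p → p ℚ.< p ℚ.+ 1ℚ
p<p+1 p = subst (ℚ._< p ℚ.+ 1ℚ) (ℚ.+-identityʳ p) (ℚ.+-monoʳ-< p (ℚ.positive⁻¹ 1ℚ))

abscissa-mono : ∀ {i j} → i ℕ.≤′ j → abscissa i ℚ.≤ abscissa j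
abscissa-mono ℕ.≤′-refl       = ℚ.≤-refl
abscissa-mono (ℕ.≤′-step i≤j) = ℚ.≤-trans (abscissa-mono i≤j) (ℚ.<⇒≤ (p<p+1 _))

abscissa-mono-< : ∀ {i j} → i < j → abscissa i ℚ.< abscissa j
abscissa-mono-< i<j = ℚ.<-≤-trans (p<p+1 _) (abscissa-mono (ℕ.≤⇒≤′ i<j))

abscissa-cancel : ∀ {i j} → abscissa i ℚ.≤ abscissa j → i ≤ j
abscissa-cancel xi≤xj = ℕ.≮⇒≥ λ j<i → ℚ.<-irrefl refl (ℚ.<-≤-trans (abscissa-mono-< j<i) xi≤xj)

abscissa-injective : Injective _≡_ _≡_ abscissa
abscissa-injective eq = ℕ.≤-antisym (abscissa-cancel (ℚ.≤-reflexive eq))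
                                    (abscissa-cancel (ℚ.≤-reflexive (sym eq)))

abscissa-lower : ∀ i {t} → InUnit t → abscissa i ℚ.≤ abscissa i ℚ.+ t
abscissa-lower i {t} (0≤t , _) = subst (ℚ._≤ abscissa i ℚ.+ t) (ℚ.+-identityʳ _) (ℚ.+-monoʳ-≤ (abscissa i) 0≤t)

abscissa-upper : ∀ i {t} → InUnit t → abscissa i ℚ.+ t ℚ.≤ abscissa (suc i)
abscissa-upper i (_ , t≤1) = ℚ.+-monoʳ-≤ (abscissa i) t≤1

abscissa-between : ∀ {i k t} → InUnit t → abscissa i ℚ.+ t ≡ abscissa k → k ≡ i ⊎ k ≡ suc i
abscissa-between {i} {k} t∈ eq with ℕ.m≤n⇒m<n∨m≡n i≤k
  where
  i≤k : i ≤ k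
  i≤k = abscissa-cancel (subst (abscissa i ℚ.≤_) eq (abscissa-lower i t∈))
... | inj₂ i≡k = inj₁ (sym i≡k)
... | inj₁ i<k = inj₂ (ℕ.≤-antisym
  (abscissa-cancel (subst (ℚ._≤ abscissa (suc i)) eq (abscissa-upper i t∈))) i<k)

-- Two distinct unit intervals with integer ends can share only an endpoint.
abscissa-overlap : ∀ {i j s t} → InUnit s → InUnit t → i < j →
                   abscissa i ℚ.+ s ≡ abscissa j ℚ.+ t →
                   j ≡ suc i × abscissa i ℚ.+ s ≡ abscissa j
abscissa-overlap {i} {j} {s} {t} s∈ t∈ i<j eq = j≡1+i , ℚ.≤-antisym
  (subst (λ l → abscissa i ℚ.+ s ℚ.≤ abscissa l) (sym j≡1+i) (abscissa-upper i s∈)) xj≤xi+s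
  where
  xj≤xi+s : abscissa j ℚ.≤ abscissa i ℚ.+ s
  xj≤xi+s = subst (abscissa j ℚ.≤_) (sym eq) (abscissa-lower j t∈)

  j≡1+i : j ≡ suc i
  j≡1+i = ℕ.≤-antisym (abscissa-cancel (ℚ.≤-trans xj≤xi+s (abscissa-upper i s∈))) i<j

-- The path occupies integer points of the horizontal axis and the hub lies at height 1, so rims
-- stay on the axis and a spoke meets it only at its foot.
place : Fin (suc m) → Point
place zero    = 0ℚ , 1ℚ
place (suc i) = abscissa (toℕ i) , 0ℚ

pointOn : Fin (suc m) × Fin (suc m) → ℚ → Point
pointOn (i , j) = along (place i) (place j)

along-rim : ∀ {i j : Fin m} t → toℕ j ≡ suc (toℕ i) →
            pointOn (suc i , suc j) t ≡ (abscissa (toℕ i) ℚ.+ t , 0ℚ)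
along-rim {i = i} t eq rewrite eq = cong₂ _,_
  (S.solve 2 (λ x t → x S.:+ t S.:* (x S.:+ S.con 1ℚ S.:- x) S.:= x S.:+ t) refl (abscissa (toℕ i)) t)
  (S.solve 1 (λ t → S.con 0ℚ S.:+ t S.:* (S.con 0ℚ S.:- S.con 0ℚ) S.:= S.con 0ℚ) refl t)

along-spoke : ∀ (i : Fin m) t →
              pointOn (zero , suc i) t ≡ (t ℚ.* abscissa (toℕ i) , 1ℚ ℚ.- t)
along-spoke i t = cong₂ _,_
  (S.solve 2 (λ x t → S.con 0ℚ S.:+ t S.:* (x S.:- S.con 0ℚ) S.:= t S.:* x) refl (abscissa (toℕ i)) t)
  (S.solve 1 (λ t → S.con 1ℚ S.:+ t S.:* (S.con 0ℚ S.:- S.con 1ℚ) S.:= S.con 1ℚ S.:- t) refl t)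

1-[1-t]≡t : ∀ t → 1ℚ ℚ.- (1ℚ ℚ.- t) ≡ t
1-[1-t]≡t = S.solve 1 (λ t → S.con 1ℚ S.:- (S.con 1ℚ S.:- t) S.:= t) refl

1-t-injective : Injective _≡_ _≡_ (λ t → 1ℚ ℚ.- t)
1-t-injective {s} {t} eq = trans (sym (1-[1-t]≡t s)) (trans (cong (λ r → 1ℚ ℚ.- r) eq) (1-[1-t]≡t t))

spoke-foot : ∀ {i : Fin m} {x t} → pointOn (zero , suc i) t ≡ (x , 0ℚ) →
             abscissa (toℕ i) ≡ x
spoke-foot {i = i} {x} {t} eq = begin
  abscissa (toℕ i)          ≡⟨ ℚ.*-identityˡ _ ⟨
  1ℚ ℚ.* abscissa (toℕ i)   ≡⟨ cong (ℚ._* _) t≡1 ⟨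
  t ℚ.* abscissa (toℕ i)    ≡⟨ cong proj₁ eq′ ⟩
  x                         ∎
  where
  open ≡-Reasoning
  eq′ : (t ℚ.* abscissa (toℕ i) , 1ℚ ℚ.- t) ≡ (x , 0ℚ)
  eq′ = trans (sym (along-spoke i t)) eq

  t≡1 : t ≡ 1ℚ
  t≡1 = 1-t-injective {t} {1ℚ} (cong proj₂ eq′)

-- Equal heights force equal parameters; a nonzero common parameter could be cancelled, making the
-- feet coincide.
spokes-meet-at-hub : ∀ {i j : Fin m} {s t} → InUnit s → i ≢ j →
  pointOn (zero , suc i) s ≡ pointOn (zero , suc j) t →
  pointOn (zero , suc i) s ≡ place {m} zero
spokes-meet-at-hub {i = i} {j} {s} {t} (0≤s , _) i≢j eq with s ℚ.≟ 0ℚ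
... | yes refl = trans (along-spoke i s) (cong (_, 1ℚ) (ℚ.*-zeroˡ (abscissa (toℕ i))))
... | no  s≢0  = contradiction (toℕ-injective (abscissa-injective sxi≡sxj⇒)) i≢j
  where
  eq′ : (s ℚ.* abscissa (toℕ i) , 1ℚ ℚ.- s) ≡ (t ℚ.* abscissa (toℕ j) , 1ℚ ℚ.- t)
  eq′ = trans (sym (along-spoke i s)) (trans eq (along-spoke j t))

  sxi≡sxj : s ℚ.* abscissa (toℕ i) ≡ s ℚ.* abscissa (toℕ j)
  sxi≡sxj = trans (cong proj₁ eq′) (cong (ℚ._* abscissa (toℕ j)) (sym (1-t-injective {s} {t} (cong proj₂ eq′))))

  instance
    s-nonZero : ℚ.NonZero s
    s-nonZero = ℚ.≢-nonZero s≢0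

  cancel : ∀ p → ℚ.1/ s ℚ.* (s ℚ.* p) ≡ p
  cancel p = trans (sym (ℚ.*-assoc (ℚ.1/ s) s p))
    (trans (cong (ℚ._* p) (ℚ.*-inverseˡ s)) (ℚ.*-identityˡ p))

  sxi≡sxj⇒ : abscissa (toℕ i) ≡ abscissa (toℕ j)
  sxi≡sxj⇒ = trans (sym (cancel _)) (trans (cong (ℚ.1/ s ℚ.*_) sxi≡sxj) (cancel _))

-- The conclusion of `noCross` with the meeting point abstracted, so that the two edges can be
-- exchanged.
CrossAtVertex : (e f : Fin (suc m) × Fin (suc m)) → Point → Set
CrossAtVertex {m} (i , j) (k , l) p =
  Σ (Fin (suc m)) λ w → (w ≡ i ⊎ w ≡ j) × (w ≡ k ⊎ w ≡ l) × p ≡ place w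

CrossAtVertex-swap : ∀ {e f : Fin (suc m) × Fin (suc m)} {p q} → p ≡ q → CrossAtVertex f e q → CrossAtVertex e f p
CrossAtVertex-swap refl (w , w∈f , w∈e , eq) = w , w∈e , w∈f , eq

rims-cross : ∀ {i j k l : Fin m} {s t} → toℕ j ≡ suc (toℕ i) → toℕ l ≡ suc (toℕ k) →
             toℕ i < toℕ k → InUnit s → InUnit t →
             pointOn (suc i , suc j) s ≡ pointOn (suc k , suc l) t →
             CrossAtVertex (suc i , suc j) (suc k , suc l) (pointOn (suc i , suc j) s)
rims-cross {k = k} {s = s} {t} i~j k~l i<k s∈ t∈ eq
  with abscissa-overlap s∈ t∈ i<k
         (cong proj₁ (trans (sym (along-rim s i~j)) (trans eq (along-rim t k~l))))
... | k≡1+i , meet =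
  suc k , inj₂ (cong suc (toℕ-injective (trans k≡1+i (sym i~j)))) , inj₁ refl ,
  trans (along-rim s i~j) (cong (_, 0ℚ) meet)

-- The meeting point has height 0, so it is the foot of the spoke; its abscissa is an integer within
-- the unit interval of the rim, hence an end of it.
rim-spoke-cross : ∀ {i j k : Fin m} {s t} → toℕ j ≡ suc (toℕ i) → InUnit s →
                  pointOn (suc i , suc j) s ≡ pointOn (zero , suc k) t →
                  CrossAtVertex (suc i , suc j) (zero , suc k) (pointOn (suc i , suc j) s)
rim-spoke-cross {m} {i} {j} {k} {s} {t} i~j s∈ eq =
  suc k , end (abscissa-between s∈ (sym foot)) , inj₂ refl ,
  trans (along-rim s i~j) (cong (_, 0ℚ) (sym foot))
  where
  foot : abscissa (toℕ k) ≡ abscissa (toℕ i) ℚ.+ s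
  foot = spoke-foot {i = k} {t = t} (trans (sym eq) (along-rim s i~j))

  end : toℕ k ≡ toℕ i ⊎ toℕ k ≡ suc (toℕ i) → _≡_ {A = Fin (suc m)} (suc k) (suc i) ⊎ suc k ≡ suc j
  end (inj₁ k≡i)   = inj₁ (cong suc (toℕ-injective k≡i))
  end (inj₂ k≡1+i) = inj₂ (cong suc (toℕ-injective (trans k≡1+i (sym i~j))))

FanEdge-noCross : ∀ {e f : Fin (suc m) × Fin (suc m)} → FanEdge e → FanEdge f → e ≢ f →
                  ∀ s t → InUnit s → InUnit t → pointOn e s ≡ pointOn f t →
                  CrossAtVertex e f (pointOn e s)
FanEdge-noCross (isSpoke i) (isSpoke j) e≢f s t s∈ t∈ eq =
  zero , inj₁ refl , inj₁ refl ,
  spokes-meet-at-hub {t = t} s∈ (λ i≡j → e≢f (cong (λ k → zero , suc k) i≡j)) eq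
FanEdge-noCross (isSpoke i) (isRim k~l) e≢f s t s∈ t∈ eq =
  CrossAtVertex-swap eq (rim-spoke-cross {t = s} k~l t∈ (sym eq))
FanEdge-noCross (isRim i~j) (isSpoke k) e≢f s t s∈ t∈ eq = rim-spoke-cross {t = t} i~j s∈ eq
FanEdge-noCross (isRim {i = i} i~j) (isRim {i = k} k~l) e≢f s t s∈ t∈ eq with ℕ.<-cmp (toℕ i) (toℕ k)
... | tri< i<k _ _ = rims-cross i~j k~l i<k s∈ t∈ eq
... | tri> _ _ k<i = CrossAtVertex-swap eq (rims-cross k~l i~j k<i t∈ s∈ (sym eq))
-- Rims with the same left end are the same edge.
... | tri≈ _ i≡k _ = contradiction
  (cong₂ (λ x y → suc x , suc y) (toℕ-injective i≡k)
    (toℕ-injective (trans i~j (trans (cong suc i≡k) (sym k~l))))) e≢f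

FanEdge-avoids : ∀ {e : Fin (suc m) × Fin (suc m)} {w} → FanEdge e → w ≢ proj₁ e → w ≢ proj₂ e →
                 ∀ t → InUnit t → pointOn e t ≢ place w
FanEdge-avoids {w = zero}  (isSpoke i) w≢0 _ t t∈ eq = w≢0 refl
FanEdge-avoids {w = suc k} (isSpoke i) _ w≢i t t∈ eq =
  w≢i (cong suc (sym (toℕ-injective (abscissa-injective (spoke-foot {i = i} {t = t} eq)))))
FanEdge-avoids {w = zero}  (isRim i~j) _ _ t t∈ eq =
  contradiction (cong proj₂ (trans (sym (along-rim t i~j)) eq)) λ ()
FanEdge-avoids {w = suc k} (isRim i~j) w≢i w≢j t t∈ eq
  with abscissa-between t∈ (cong proj₁ (trans (sym (along-rim t i~j)) eq))
... | inj₁ k≡i   = w≢i (cong suc (toℕ-injective k≡i))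
... | inj₂ k≡1+i = w≢j (cong suc (toℕ-injective (trans k≡1+i (sym i~j))))

place-injective : ∀ (x y : Fin (suc m)) → place x ≡ place y → x ≡ y
place-injective zero    zero    _  = refl
place-injective zero    (suc j) eq = contradiction (cong proj₂ eq) λ ()
place-injective (suc i) zero    eq = contradiction (cong proj₂ eq) λ ()
place-injective (suc i) (suc j) eq = cong suc (toℕ-injective (abscissa-injective (cong proj₁ eq)))

FanEdges⇒planar : ∀ (G : SimpleGraph (suc m)) → All FanEdge (edges G) → Planar G
FanEdges⇒planar G fanEdges = place , record
  { injective = place-injective
  ; avoids    = λ e∈G → FanEdge-avoids (All.lookup fanEdges e∈G)
  ; noCross   = λ e∈G f∈G → FanEdge-noCross (All.lookup fanEdges e∈G) (All.lookup fanEdges f∈G)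
  }

-- Feasibility and enumeration of the vectors

treeVector-feasible : ∀ (bs : Vec Bool n) → PlanarFeasible (n + 2) (treeVector bs)
treeVector-feasible {n} bs =
  suc n , ℕ.≤-reflexive (ℕ.+-comm 2 n) , fan bs ,
  FanEdges⇒planar (fan bs) (isSpoke 0F ∷ unmarked-FanEdge bs) ,
  0F , τ-contract bs _ , τ-delete bs

-- Binary digits, leading one first; `2 ^ suc n` unfolds to `2 * 2 ^ n`, which is what `quotient`
-- and `remainder` split.
bits : ∀ n → Fin (2 ^ n) → Vec Bool n
bits zero    _ = []
bits (suc n) i = Inverse.to 2↔Bool (quotient (2 ^ n) i) ∷ bits n (remainder {2} (2 ^ n) i)

bits-injective : ∀ n → Injective _≡_ _≡_ (bits n)
bits-injective zero    {0F} {0F} _  = refl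
bits-injective (suc n) {i}  {j}  eq = begin
  i                                            ≡⟨ combine-remQuot {2} (2 ^ n) i ⟨
  combine (quotient (2 ^ n) i) (remainder {2} (2 ^ n) i)
    ≡⟨ cong₂ combine (Injection.injective (↔⇒↣ 2↔Bool) (Vec.∷-injectiveˡ eq))
                     (bits-injective n (Vec.∷-injectiveʳ eq)) ⟩
  combine (quotient (2 ^ n) j) (remainder {2} (2 ^ n) j) ≡⟨ combine-remQuot {2} (2 ^ n) j ⟩
  j                                            ∎
  where open ≡-Reasoning

theorem2p5 : (n : ℕ) →
    Σ (Fin (2 ^ n) → ℕ × ℕ) λ f →
    Injective _≡_ _≡_ f × ((i : Fin (2 ^ n)) → PlanarFeasible (n + 2) (f i))
theorem2p5 n = treeVector ∘ bits n , bits-injective n ∘ treeVector-injective , treeVector-feasible ∘ bits n
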